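{- Let $p$ and $p'$ be consecutive patterns of the same length $r$ that are non-overlapping, mutually non-overlapping, and interchangeable. Then for all $n$ and all $S,T\subseteq[n]$, $$|\{e\in\mathbf{I}_n:\mathrm{Em}(p,e)=S,\ \mathrm{Em}(p',e)=T\}|=|\{e\in\mathbf{I}_n:\mathrm{Em}(p,e)=T,\ \mathrm{Em}(p',e)=S\}|.$$ In particular, $p$ and $p'$ are super-strongly Wilf equivalent.
   Context: An inversion sequence of length $n$ is an integer sequence $e=e_1e_2\dots e_n$ with $0\le e_i<i$ for all $i$; $\mathbf{I}_n$ denotes the set of these. A pattern of length $r$ is a sequence $p=p_1\dots p_r$ with $p_i\in\{0,\dots,r-1\}$ such that whenever a value $j>0$ appears in $p$, the value $j-1$ also appears. The reduction of an integer word $w$ is obtained by replacing every occurrence of the $i$-th smallest distinct value of $w$ by $i-1$. An inversion sequence $e$ has an occurrence of the consecutive pattern $p$ in position $i$ if the reduction of $e_i\dots e_{i+r-1}$ equals $p$; $\mathrm{Em}(p,e)$ is the set of such positions. $p=p_1\dots p_r$ is non-overlapping if for every $1<i<r$ the reductions of $p_1\dots p_i$ and $p_{r-i+1}\dots p_r$ differ. $p,p'$ (both of length $r$) are mutually non-overlapping if for every $1<i<r$ the reductions of $p_1\dots p_i$ and $p'_{r-i+1}\dots p'_r$ differ, and the reductions of $p'_1\dots p'_i$ and $p_{r-i+1}\dots p_r$ differ. Given patterns $p,p'$ of length $r$ with $p_1=p'_1$, $p_r=p'_r$ and $\max_i p_i=\max_i p'_i$, $p$ is changeable for $p'$ if for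 all $1\le i\le r$, $p'_i\le\max(\{p_j:1\le j\le i\}\cup\{p_j-j+i: i<j\le r\})$; $p$ and $p'$ are interchangeable if each is changeable for the other. Two patterns are super-strongly Wilf equivalent if $|\{e\in\mathbf{I}_n:\mathrm{Em}(p,e)=T\}|=|\{e\in\mathbf{I}_n:\mathrm{Em}(p',e)=T\}|$ for all $n$ and all $T\subseteq[n]$. -}

module Defs where

open import Data.Bool.Properties as Bool using ()
open import Data.Fin using (Fin; toℕ; fromℕ; inject₁)
open import Data.Fin.Properties using (toℕ-fromℕ; toℕ-inject₁)
open import Data.Fin.Relation.Unary.Top using (view; ‵fromℕ; ‵inject₁)
open import Data.Fin.Subset using (Subset)
open import Data.List as List using (List; length; filter; deduplicate; cartesianProductWith; upTo; allFin; _++_)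
open import Data.List.Extrema.Nat using (max)
open import Data.List.Membership.Propositional using (_∈_)
open import Data.List.Membership.Propositional.Properties using (∈-cartesianProductWith⁺; ∈-cartesianProductWith⁻; ∈-upTo⁺; ∈-upTo⁻)
open import Data.List.Properties as List using ()
open import Data.List.Relation.Unary.All using ([])
open import Data.List.Relation.Unary.AllPairs using ([]; _∷_)
open import Data.List.Relation.Unary.Any using (here)
open import Data.List.Relation.Unary.Unique.Propositional using (Unique)
open import Data.List.Relation.Unary.Unique.Propositional.Properties using (cartesianProductWith⁺; upTo⁺)
open import Data.Nat using (ℕ; zero; suc; _+_; _∸_; _≤_; _<_; _<?_; _≤?_; _≟_)
open import Data.Product using (_×_; _,_)
open import Data.Vec as Vec using (Vec; []; _∷_; _∷ʳ_; lookup; toList; tabulate)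
open import Data.Vec.Membership.Propositional as Vec using ()
open import Data.Vec.Properties using (≡-dec; ∷ʳ-injective)
open import Function using (_⇔_; mk⇔)
open import Level using (Level)
open import Relation.Binary using (DecidableEquality)
open import Relation.Binary.PropositionalEquality using (_≡_; _≢_; refl; sym; cong; subst₂)
open import Relation.Nullary using (does)
open import Relation.Nullary.Decidable using (_×-dec_)
open import Relation.Unary using (Pred; Decidable)

private
  variable
    n r s : ℕ
    ℓ : Level

-- The paper's positions 1, …, n are the elements 0, …, n-1 of Fin n, so the
-- paper's index is suc (toℕ i).

InversionSequence : Vec ℕ n → Set
InversionSequence e = ∀ i → lookup e i < suc (toℕ i)

-- The set 𝐈ₙ, listed without repetition.

inversionSequences : ∀ n → List (Vec ℕ n)
inversionSequences zero    = List.[ [] ]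
inversionSequences (suc n) = cartesianProductWith _∷ʳ_ (inversionSequences n) (upTo (suc n))

private
  lookup-∷ʳ-inject₁ : ∀ (xs : Vec ℕ n) x i → lookup (xs ∷ʳ x) (inject₁ i) ≡ lookup xs i
  lookup-∷ʳ-inject₁ (_ ∷ _)  x Fin.zero    = refl
  lookup-∷ʳ-inject₁ (_ ∷ xs) x (Fin.suc i) = lookup-∷ʳ-inject₁ xs x i

  lookup-∷ʳ-fromℕ : ∀ (xs : Vec ℕ n) x → lookup (xs ∷ʳ x) (fromℕ n) ≡ x
  lookup-∷ʳ-fromℕ []       x = refl
  lookup-∷ʳ-fromℕ (_ ∷ xs) x = lookup-∷ʳ-fromℕ xs x

inversionSequences-unique : ∀ n → Unique (inversionSequences n)
inversionSequences-unique zero    = [] ∷ []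
inversionSequences-unique (suc n) =
  cartesianProductWith⁺ _∷ʳ_ (λ {xs} {ys} → ∷ʳ-injective xs ys) (inversionSequences-unique n) (upTo⁺ (suc n))

∈-inversionSequences⁺ : (e : Vec ℕ n) → InversionSequence e → e ∈ inversionSequences n
∈-inversionSequences⁺ {zero}  []  _ = here refl
∈-inversionSequences⁺ {suc n} e inv with Vec.initLast e
... | xs , x , refl = ∈-cartesianProductWith⁺ _∷ʳ_
  (∈-inversionSequences⁺ xs (λ i →
    subst₂ _<_ (lookup-∷ʳ-inject₁ xs x i) (cong suc (toℕ-inject₁ i)) (inv (inject₁ i))))
  (∈-upTo⁺ (subst₂ _<_ (lookup-∷ʳ-fromℕ xs x) (cong suc (toℕ-fromℕ n)) (inv (fromℕ n))))

∈-inversionSequences⁻ : (e : Vec ℕ n) → e ∈ inversionSequences n → InversionSequence e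
∈-inversionSequences⁻ {suc n} e e∈ i
  with ∈-cartesianProductWith⁻ _∷ʳ_ (inversionSequences n) (upTo (suc n)) e∈
... | xs , x , xs∈ , x∈ , refl with view i
...   | ‵fromℕ = subst₂ _<_
          (sym (lookup-∷ʳ-fromℕ xs x)) (sym (cong suc (toℕ-fromℕ n))) (∈-upTo⁻ x∈)
...   | ‵inject₁ j = subst₂ _<_
          (sym (lookup-∷ʳ-inject₁ xs x j)) (sym (cong suc (toℕ-inject₁ j)))
          (∈-inversionSequences⁻ xs xs∈ j)

∈-inversionSequences : (e : Vec ℕ n) → e ∈ inversionSequences n ⇔ InversionSequence e
∈-inversionSequences e = mk⇔ (∈-inversionSequences⁻ e) (∈-inversionSequences⁺ e)

-- The cardinality of { e ∈ 𝐈ₙ : P e }.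

#𝐈 : {P : Pred (Vec ℕ n) ℓ} → Decidable P → ℕ
#𝐈 {n = n} P? = length (filter P? (inversionSequences n))

-- A value v that is the i-th smallest distinct value of w has exactly i-1
-- distinct values of w below it.

rank : List ℕ → ℕ → ℕ
rank w v = length (filter (_<? v) (deduplicate _≟_ w))

reduction : List ℕ → List ℕ
reduction w = List.map (rank w) w

record IsPattern {r : ℕ} (p : Vec ℕ r) : Set where
  field
    bounded : ∀ i → lookup p i < r
    gapless : ∀ {j} → suc j Vec.∈ p → j Vec.∈ p

-- When fewer than r entries of e remain from position i on, the window is
-- shorter than p, so p does not occur there.

Occurs : Vec ℕ r → Vec ℕ n → Pred (Fin n) _
Occurs {r = r} p e i = reduction (List.take r (List.drop (toℕ i) (toList e))) ≡ toList p

occurs? : (p : Vec ℕ r) (e : Vec ℕ n) → Decidable (Occurs p e)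
occurs? p e i = List.≡-dec _≟_ _ _

Em : Vec ℕ r → Vec ℕ n → Subset n
Em p e = tabulate (λ i → does (occurs? p e i))

_≟ˢ_ : DecidableEquality (Subset n)
_≟ˢ_ = ≡-dec Bool._≟_

#Em : Vec ℕ r → Subset n → ℕ
#Em p T = #𝐈 (λ e → Em p e ≟ˢ T)

#Em² : Vec ℕ r → Vec ℕ s → Subset n → Subset n → ℕ
#Em² p p′ S T = #𝐈 (λ e → (Em p e ≟ˢ S) ×-dec (Em p′ e ≟ˢ T))

SuperStronglyWilfEquivalent : Vec ℕ r → Vec ℕ s → Set
SuperStronglyWilfEquivalent p p′ = ∀ n (T : Subset n) → #Em p T ≡ #Em p′ T

prefix suffix : ℕ → Vec ℕ r → List ℕ
prefix         i p = List.take i (toList p)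
suffix {r = r} i p = List.drop (r ∸ i) (toList p)

PrefixesAvoidSuffixes : Vec ℕ r → Vec ℕ r → Set
PrefixesAvoidSuffixes {r = r} p q =
  ∀ i → 1 < i → i < r → reduction (prefix i p) ≢ reduction (suffix i q)

NonOverlapping : Vec ℕ r → Set
NonOverlapping p = PrefixesAvoidSuffixes p p

MutuallyNonOverlapping : Vec ℕ r → Vec ℕ r → Set
MutuallyNonOverlapping p p′ = PrefixesAvoidSuffixes p p′ × PrefixesAvoidSuffixes p′ p

maximum : Vec ℕ r → ℕ
maximum p = max 0 (toList p)

-- The maximum of { pⱼ : j ≤ i } ∪ { pⱼ - j + i : i < j }.  The first set
-- contains a natural number, so neither truncating pⱼ - j + i at 0 nor using
-- 0 as the default value changes the maximum.  The shift between Fin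
-- positions and the paper's indices cancels in i - j.

changeBound : Vec ℕ r → Fin r → ℕ
changeBound {r = r} p i = max 0
  (  List.map (λ j → lookup p j)                   (filter (λ j → toℕ j ≤? toℕ i) (allFin r))
  ++ List.map (λ j → (lookup p j + toℕ i) ∸ toℕ j) (filter (λ j → toℕ i <? toℕ j) (allFin r)))

record Changeable (p p′ : Vec ℕ (suc r)) : Set where
  field
    sameHead    : Vec.head p ≡ Vec.head p′
    sameLast    : Vec.last p ≡ Vec.last p′
    sameMaximum : maximum p ≡ maximum p′
    change      : ∀ i → lookup p′ i ≤ changeBound p i

Interchangeable : Vec ℕ (suc r) → Vec ℕ (suc r) → Set
Interchangeable p p′ = Changeable p p′ × Changeable p′ p

{-# OPTIONS --safe #-}
-- Exchange all occurrences of p and p′ in e simultaneously, keeping the set of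
-- values of each window.  By the non-overlapping conditions two occurrences
-- share at most one letter, which is the last of one and the first of the other
-- and therefore does not change, so the exchange is well defined.  It creates
-- no further occurrence: one meeting an exchanged window in at least two
-- letters would overlap an occurrence, and any other window is unchanged.
-- Hence the exchange is an involution.  It preserves inversion sequences: write
-- v_0 < v_1 < … for the values of an occurrence of p at position i, so that its
-- letter at offset t is v_{p_t} and becomes v_{p′_t}.  If p′_t ≤ p_j with j ≤ t,
-- then v_{p′_t} ≤ v_{p_j} ≤ i + j ≤ i + t; if p′_t ≤ p_j - j + t with j > t, then
-- v_{p′_t} ≤ v_{p_j} - (p_j - p′_t) ≤ i + t, as the v are distinct integers.
module Submission where

open import Defs
open import Data.Bool using (Bool; true; false; not; if_then_else_)
open import Data.Bool.Properties as Bool using (not-involutive)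
open import Data.Fin as Fin using (Fin; toℕ; fromℕ<)
open import Data.Fin.Properties using (toℕ<n; toℕ-fromℕ<)
open import Data.Fin.Subset using (Subset)
open import Data.List as List using (List; []; _∷_; length; filter; deduplicate; applyUpTo; allFin; take; drop; _++_)
open import Data.List.Extrema.Nat using (max; argmax-sel; xs≤max)
open import Data.List.Membership.Propositional using (_∈_)
open import Data.List.Membership.Propositional.Properties
  using (∈-∃++; ∈-++⁺ˡ; ∈-++⁺ʳ; ∈-++⁻; ∈-filter⁺; ∈-filter⁻; ∈-map⁺; ∈-map⁻; ∈-map∘filter⁻;
         ∈-deduplicate⁺; ∈-deduplicate⁻; ∈-applyUpTo⁺; ∈-applyUpTo⁻)
open import Data.List.Properties as List
  using (length-++; length-map; length-take; length-drop; map-cong-local; map-∘; take-map; drop-map;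
         map-applyUpTo; ∷-injectiveˡ; ∷-injectiveʳ)
open import Data.List.Relation.Binary.Sublist.Propositional as Sublist using ()
open import Data.List.Relation.Binary.Sublist.Propositional.Properties as Sublist using ()
open import Data.List.Relation.Binary.Subset.Propositional using (_⊆_)
open import Data.List.Relation.Unary.All as All using ([]; _∷_)
open import Data.List.Relation.Unary.All.Properties as All using ()
open import Data.List.Relation.Unary.AllPairs using ([]; _∷_)
open import Data.List.Relation.Unary.Any using (here; there)
open import Data.List.Relation.Unary.Unique.DecPropositional.Properties using (deduplicate-!)
open import Data.List.Relation.Unary.Unique.Propositional using (Unique)
open import Data.List.Relation.Unary.Unique.Propositional.Properties as Unique using ()
open import Data.Nat
open import Data.Nat.Properties
open import Data.Product using (_×_; _,_; proj₁; proj₂; ∃-syntax; -,_)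
open import Data.Sum using (_⊎_; inj₁; inj₂; [_,_]′)
open import Data.Vec as Vec using (Vec; []; _∷_; lookup; toList; tabulate)
open import Data.Vec.Membership.Propositional as Vec using ()
open import Data.Vec.Membership.Propositional.Properties using (∈-lookup; ∈-toList⁺; ∈-toList⁻)
open import Data.Vec.Properties using (tabulate-cong; length-toList)
open import Data.Vec.Relation.Unary.Any as VecAny using ()
open import Data.Vec.Relation.Unary.Any.Properties as VecAny using ()
open import Function using (id; _∘_; mk⇔)
open import Level using (Level)
open import Relation.Binary using (tri<; tri≈; tri>)
open import Relation.Binary.PropositionalEquality
open import Relation.Nullary using (¬_; Dec; yes; no; contradiction)
open import Relation.Nullary.Decidable using (_×-dec_; _⊎-dec_; map′; does-⇔)
open import Relation.Unary using (Pred; Decidable)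

private
  variable
    a a′ : Level
    A : Set a
    B : Set a′
    xs ys : List A
    x y n r : ℕ

-- Ranks and reductions

-- Delete one occurrence of the head of `xs` from `ys`: by uniqueness the other elements of `xs`
-- differ from it, so they still lie in what is left. Inequalities between ranks and between
-- cardinalities all reduce to this.
unique-⊆⇒length≤ : Unique xs → xs ⊆ ys → length xs ≤ length ys
unique-⊆⇒length≤ []                          _  = z≤n
unique-⊆⇒length≤ {xs = x ∷ xs} (x∉xs ∷ uniq) ⊆ys with ∈-∃++ (⊆ys (here refl))
... | as , bs , refl = begin
  suc (length xs)              ≤⟨ s≤s (unique-⊆⇒length≤ uniq xs⊆) ⟩
  suc (length (as ++ bs))      ≡⟨ cong suc (length-++ as) ⟩
  suc (length as + length bs)  ≡⟨ +-suc (length as) (length bs) ⟨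
  length as + suc (length bs)  ≡⟨ length-++ as ⟨
  length (as ++ x ∷ bs)        ∎
  where
  open ≤-Reasoning
  xs⊆ : xs ⊆ as ++ bs
  xs⊆ z∈xs with ∈-++⁻ as (⊆ys (there z∈xs))
  ... | inj₁ z∈as         = ∈-++⁺ˡ z∈as
  ... | inj₂ (here refl)  = contradiction refl (All.lookup x∉xs z∈xs)
  ... | inj₂ (there z∈bs) = ∈-++⁺ʳ as z∈bs

-- `rank w v` is by definition the length of this list, so ranks can be compared through inclusions.
below : List ℕ → ℕ → List ℕ
below w v = filter (_<? v) (deduplicate _≟_ w)

below-unique : ∀ w v → Unique (below w v)
below-unique w v = Unique.filter⁺ (_<? v) (deduplicate-! _≟_ w)

∈-below⁺ : ∀ w {v} → x ∈ w → x < v → x ∈ below w v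
∈-below⁺ w x∈w = ∈-filter⁺ (_<? _) (∈-deduplicate⁺ _≟_ x∈w)

∈-below⁻ : ∀ w {v} → x ∈ below w v → x ∈ w × x < v
∈-below⁻ w x∈ with ∈-filter⁻ (_<? _) {xs = deduplicate _≟_ w} x∈
... | x∈w , x<v = ∈-deduplicate⁻ _≟_ w x∈w , x<v

rank-mono-⊆ : ∀ {w w′} → w ⊆ w′ → ∀ v → rank w v ≤ rank w′ v
rank-mono-⊆ {w} {w′} w⊆w′ v = unique-⊆⇒length≤ (below-unique w v) λ x∈ →
  let x∈w , x<v = ∈-below⁻ w x∈ in ∈-below⁺ w′ (w⊆w′ x∈w) x<v

rank-cong : ∀ {w w′} → w ⊆ w′ → w′ ⊆ w → ∀ v → rank w v ≡ rank w′ v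
rank-cong w⊆w′ w′⊆w v = ≤-antisym (rank-mono-⊆ w⊆w′ v) (rank-mono-⊆ w′⊆w v)

-- The value `x` is itself counted below `y` but not below `x`.
rank-mono-< : ∀ w → x ∈ w → x < y → rank w x < rank w y
rank-mono-< {x} {y} w x∈w x<y =
  unique-⊆⇒length≤ (All.tabulate (λ z∈ x≡z → <⇒≢ (proj₂ (∈-below⁻ w z∈)) (sym x≡z)) ∷ below-unique w x) λ where
    (here refl) → ∈-below⁺ w x∈w x<y
    (there z∈)  → let z∈w , z<x = ∈-below⁻ w z∈ in ∈-below⁺ w z∈w (<-trans z<x x<y)

rank-cancel-≤ : ∀ w → y ∈ w → rank w x ≤ rank w y → x ≤ y
rank-cancel-≤ w y∈w rx≤ry = ≮⇒≥ λ y<x → <⇒≱ (rank-mono-< w y∈w y<x) rx≤ry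

rank-injective : ∀ w → x ∈ w → y ∈ w → rank w x ≡ rank w y → x ≡ y
rank-injective w x∈w y∈w eq =
  ≤-antisym (rank-cancel-≤ w y∈w (≤-reflexive eq)) (rank-cancel-≤ w x∈w (≤-reflexive (sym eq)))

rank-suc : ∀ w v → rank w (suc v) ≤ suc (rank w v)
rank-suc w v = unique-⊆⇒length≤ {ys = v ∷ below w v} (below-unique w (suc v)) ⊆v∷
  where
  ⊆v∷ : below w (suc v) ⊆ v ∷ below w v
  ⊆v∷ x∈ with ∈-below⁻ w x∈
  ... | x∈w , s≤s x≤v with m≤n⇒m<n∨m≡n x≤v
  ...   | inj₁ x<v  = there (∈-below⁺ w x∈w x<v)
  ...   | inj₂ refl = here refl

-- Each of the `k` integers from `x` up to but excluding `k + x` contributes at most one distinct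
-- value, so ranks grow no faster than values. This serves the second alternative of changeability.
rank-gap : ∀ w x k → rank w (k + x) ≤ k + rank w x
rank-gap w x zero    = ≤-refl
rank-gap w x (suc k) = ≤-trans (rank-suc w (k + x)) (s≤s (rank-gap w x k))

StrictlyMonoOn : List ℕ → (ℕ → ℕ) → Set
StrictlyMonoOn w f = ∀ {x y} → x ∈ w → y ∈ w → x < y → f x < f y

strictlyMonoOn⇒cancel-< : ∀ {w f} → StrictlyMonoOn w f → x ∈ w → y ∈ w → f x < f y → x < y
strictlyMonoOn⇒cancel-< {x} {y} mono x∈w y∈w fx<fy with <-cmp x y
... | tri< x<y _ _  = x<y
... | tri≈ _ refl _ = contradiction fx<fy (<-irrefl refl)
... | tri> _ _ y<x  = contradiction (mono y∈w x∈w y<x) (<-asym fx<fy)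

strictlyMonoOn⇒injective : ∀ {w f} → StrictlyMonoOn w f → x ∈ w → y ∈ w → f x ≡ f y → x ≡ y
strictlyMonoOn⇒injective {x} {y} mono x∈w y∈w fx≡fy with <-cmp x y
... | tri< x<y _ _ = contradiction fx≡fy (<⇒≢ (mono x∈w y∈w x<y))
... | tri≈ _ x≡y _ = x≡y
... | tri> _ _ y<x = contradiction (sym fx≡fy) (<⇒≢ (mono y∈w x∈w y<x))

map-injectiveOn-unique : ∀ {f : A → B} → (∀ {x y} → x ∈ xs → y ∈ xs → f x ≡ f y → x ≡ y) →
                         Unique xs → Unique (List.map f xs)
map-injectiveOn-unique _ [] = []
map-injectiveOn-unique {f = f} inj (x∉xs ∷ uniq) =
  All.map⁺ (All.tabulate λ y∈ fx≡fy → All.lookup x∉xs y∈ (inj (here refl) (there y∈) fx≡fy)) ∷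
  map-injectiveOn-unique (λ x∈ y∈ → inj (there x∈) (there y∈)) uniq

-- On the values of `w` the map `f` is injective and reflects the order, so it carries those below
-- `v` bijectively to those of the image below `f v`.
rank-map : ∀ {f} w → StrictlyMonoOn w f → ∀ {v} → v ∈ w → rank (List.map f w) (f v) ≡ rank w v
rank-map {f} w mono {v} v∈w = ≤-antisym
  (subst (rank (List.map f w) (f v) ≤_) (length-map f (below w v))
    (unique-⊆⇒length≤ (below-unique (List.map f w) (f v)) below-map⊆map-below))
  (subst (_≤ rank (List.map f w) (f v)) (length-map f (below w v))
    (unique-⊆⇒length≤ (map-injectiveOn-unique injective (below-unique w v)) map-below⊆below-map))
  where
  injective : ∀ {x y} → x ∈ below w v → y ∈ below w v → f x ≡ f y → x ≡ y
  injective x∈ y∈ = strictlyMonoOn⇒injective mono (proj₁ (∈-below⁻ w x∈)) (proj₁ (∈-below⁻ w y∈))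

  below-map⊆map-below : below (List.map f w) (f v) ⊆ List.map f (below w v)
  below-map⊆map-below y∈ with ∈-below⁻ (List.map f w) y∈
  ... | fx∈ , fx<fv with ∈-map⁻ f fx∈
  ...   | x , x∈w , refl = ∈-map⁺ f (∈-below⁺ w x∈w (strictlyMonoOn⇒cancel-< mono x∈w v∈w fx<fv))

  map-below⊆below-map : List.map f (below w v) ⊆ below (List.map f w) (f v)
  map-below⊆below-map y∈ with ∈-map⁻ f y∈
  ... | x , x∈ , refl = let x∈w , x<v = ∈-below⁻ w x∈ in
    ∈-below⁺ (List.map f w) (∈-map⁺ f x∈w) (mono x∈w v∈w x<v)

reduction-map : ∀ {f} w → StrictlyMonoOn w f → reduction (List.map f w) ≡ reduction w
reduction-map w mono = trans (sym (map-∘ w)) (map-cong-local (All.tabulate (rank-map w mono)))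

reduction-map-rank : ∀ w {u} → u ⊆ w → reduction (List.map (rank w) u) ≡ reduction u
reduction-map-rank w {u} u⊆w = reduction-map u λ x∈u _ → rank-mono-< w (u⊆w x∈u)

-- Ranking within the whole of `w` keeps the order of the letters of a factor. Together with
-- `reduction-drop` this turns an overlap of two occurrences into a statement about a prefix and a
-- suffix of the patterns.
reduction-take : ∀ k w → reduction (take k (reduction w)) ≡ reduction (take k w)
reduction-take k w = trans (cong reduction (take-map k w))
  (reduction-map-rank w (Sublist.lookup (Sublist.take-⊆ k w)))

reduction-drop : ∀ k w → reduction (drop k (reduction w)) ≡ reduction (drop k w)
reduction-drop k w = trans (cong reduction (drop-map k w))
  (reduction-map-rank w (Sublist.lookup (Sublist.drop-⊆ k w)))

-- Lists and vectors as functions of the position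

applyUpTo-cong : ∀ {f g : ℕ → A} k → (∀ {t} → t < k → f t ≡ g t) → applyUpTo f k ≡ applyUpTo g k
applyUpTo-cong zero    _  = refl
applyUpTo-cong (suc k) eq = cong₂ _∷_ (eq z<s) (applyUpTo-cong k (eq ∘ s<s))

applyUpTo-injective : ∀ (f g : ℕ → A) k → applyUpTo f k ≡ applyUpTo g k → ∀ {t} → t < k → f t ≡ g t
applyUpTo-injective f g (suc k) eq {zero}  _         = ∷-injectiveˡ eq
applyUpTo-injective f g (suc k) eq {suc t} (s<s t<k) = applyUpTo-injective (f ∘ suc) (g ∘ suc) k (∷-injectiveʳ eq) t<k

take-applyUpTo : ∀ (f : ℕ → A) {k n} → k ≤ n → take k (applyUpTo f n) ≡ applyUpTo f k
take-applyUpTo f z≤n       = refl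
take-applyUpTo f (s≤s k≤n) = cong (f 0 ∷_) (take-applyUpTo (f ∘ suc) k≤n)

drop-applyUpTo : ∀ (f : ℕ → A) k n → drop k (applyUpTo f n) ≡ applyUpTo (λ t → f (k + t)) (n ∸ k)
drop-applyUpTo f zero    n       = refl
drop-applyUpTo f (suc k) zero    = refl
drop-applyUpTo f (suc k) (suc n) = drop-applyUpTo (f ∘ suc) k n

-- Positions are natural numbers from here on; entries past the end are 0.
at : Vec ℕ n → ℕ → ℕ
at []       _       = 0
at (x ∷ _)  zero    = x
at (_ ∷ xs) (suc i) = at xs i

toList-at : (v : Vec ℕ n) → toList v ≡ applyUpTo (at v) n
toList-at []       = refl
toList-at (x ∷ xs) = cong (x ∷_) (toList-at xs)

lookup-at : ∀ (v : Vec ℕ n) i → lookup v i ≡ at v (toℕ i)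
lookup-at (x ∷ _)  Fin.zero    = refl
lookup-at (_ ∷ xs) (Fin.suc i) = lookup-at xs i

at-tabulate : ∀ (f : ℕ → ℕ) n {i} → i < n → at (tabulate {n = n} (f ∘ toℕ)) i ≡ f i
at-tabulate f (suc n) {zero}  _         = refl
at-tabulate f (suc n) {suc i} (s<s i<n) = at-tabulate (f ∘ suc) n i<n

at-injective : (v w : Vec ℕ n) → (∀ {i} → i < n → at v i ≡ at w i) → v ≡ w
at-injective []      []      _  = refl
at-injective (_ ∷ v) (_ ∷ w) eq = cong₂ _∷_ (eq z<s) (at-injective v w (eq ∘ s<s))

window : ℕ → (ℕ → ℕ) → ℕ → List ℕ
window r g i = applyUpTo (λ t → g (i + t)) r

window-at : ∀ (e : Vec ℕ n) i → i + r ≤ n → take r (drop i (toList e)) ≡ window r (at e) i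
window-at {n} {r} e i i+r≤n = begin
  take r (drop i (toList e))                       ≡⟨ cong (take r ∘ drop i) (toList-at e) ⟩
  take r (drop i (applyUpTo (at e) n))             ≡⟨ cong (take r) (drop-applyUpTo (at e) i n) ⟩
  take r (applyUpTo (λ t → at e (i + t)) (n ∸ i))  ≡⟨ take-applyUpTo _ r≤n∸i ⟩
  window r (at e) i                                ∎
  where
  open ≡-Reasoning
  r≤n∸i : r ≤ n ∸ i
  r≤n∸i = m+n≤o⇒m≤o∸n r (subst (_≤ n) (+-comm i r) i+r≤n)

anyBool? : ∀ {ℓ} {Q : Pred Bool ℓ} → Decidable Q → Dec (∃[ b ] Q b)
anyBool? Q? = map′ [ (true ,_) , (false ,_) ]′
  (λ { (true , q) → inj₁ q ; (false , q) → inj₂ q })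
  (Q? true ⊎-dec Q? false)

-- The pair p, p′ is indexed by Bool, so that not exchanges its members.
module Swap {m : ℕ} (P : Bool → Vec ℕ (suc m))
  (avoid  : ∀ b c → PrefixesAvoidSuffixes (P b) (P c))
  (first≡ : ∀ b → at (P b) 0 ≡ at (P (not b)) 0)
  (last≡  : ∀ b → at (P b) m ≡ at (P (not b)) m)
  (values : ∀ b {d} → d < suc m → ∃[ t ] t < suc m × at (P b) t ≡ at (P (not b)) d)
  (change : ∀ b {d} → d < suc m → ∃[ t ] t < suc m ×
    (t ≤ d × at (P (not b)) d ≤ at (P b) t ⊎ d < t × at (P (not b)) d + t ≤ at (P b) t + d))
  (n : ℕ)
  where

  -- Occurrences and their overlaps

  private
    variable
      b c : Bool
      d t i j : ℕ
      g h : ℕ → ℕ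

    len : ℕ
    len = suc m

  -- Since `g` is total, a window beyond position `n` could also reduce to the pattern; `fits`
  -- excludes this.
  record OccursAt (g : ℕ → ℕ) (b : Bool) (j : ℕ) : Set where
    constructor occursAt
    field
      fits    : j + len ≤ n
      reduced : reduction (window len g j) ≡ toList (P b)

  open OccursAt

  occursAt? : ∀ g b j → Dec (OccursAt g b j)
  occursAt? g b j = map′ (λ (le , eq) → occursAt le eq) (λ occ → fits occ , reduced occ)
    (j + len ≤? n ×-dec List.≡-dec _≟_ _ _)

  ∈-window : ∀ (g : ℕ → ℕ) j → t < len → g (j + t) ∈ window len g j
  ∈-window g j = ∈-applyUpTo⁺ (λ t → g (j + t))

  reduction-window : ∀ g j → reduction (window len g j) ≡ applyUpTo (λ t → rank (window len g j) (g (j + t))) len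
  reduction-window g j = map-applyUpTo (λ t → g (j + t)) (rank (window len g j)) len

  rank-window : OccursAt g b j → t < len → rank (window len g j) (g (j + t)) ≡ at (P b) t
  rank-window {g} {b} {j} (occursAt _ eq) = applyUpTo-injective (λ t → rank (window len g j) (g (j + t))) (at (P b)) len
    (trans (sym (reduction-window g j)) (trans eq (toList-at (P b))))

  occursAt-injective : OccursAt g b j → d < len → t < len → at (P b) d ≡ at (P b) t → g (j + d) ≡ g (j + t)
  occursAt-injective {g} {b} {j} occ d<len t<len eq =
    rank-injective (window len g j) (∈-window g j d<len) (∈-window g j t<len)
      (trans (rank-window occ d<len) (trans eq (sym (rank-window occ t<len))))

  occursAt-cong : (∀ {t} → t < len → g (j + t) ≡ h (j + t)) → OccursAt g b j → OccursAt h b j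
  occursAt-cong eq (occursAt j≤ occ) = occursAt j≤ (trans (cong reduction (sym (applyUpTo-cong len eq))) occ)

  occursAt-unique : OccursAt g b j → OccursAt g c j → toList (P b) ≡ toList (P c)
  occursAt-unique (occursAt _ eq) (occursAt _ eq′) = trans (sym eq) eq′

  -- Otherwise the windows share `k = len ∸ suc d` letters with `1 < k < len`. Their common factor
  -- is a suffix of the first window and a prefix of the second, so a prefix of `P c` and a suffix
  -- of `P b` have the same reduction, against `avoid`.
  overlap-free : OccursAt g b i → OccursAt g c (suc i + d) → i + len ≤ suc (suc i + d)
  overlap-free {g} {b} {i} {c} {d} (occursAt _ occ) (occursAt _ occ′) = ≮⇒≥ λ i′+1<i+len →
    let
      2+d<len : 2 + d < len
      2+d<len = +-cancelˡ-< i _ _ (subst (_< i + len) (sym (trans (+-suc i (suc d)) (cong suc (+-suc i d)))) i′+1<i+len)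
    in avoid c b k (m+n≤o⇒m≤o∸n 2 2+d<len) (s≤s (m∸n≤m m d)) (begin
      reduction (take k (toList (P c)))
        ≡⟨ cong (reduction ∘ take k) occ′ ⟨
      reduction (take k (reduction (window len g i′)))
        ≡⟨ reduction-take k (window len g i′) ⟩
      reduction (take k (window len g i′))
        ≡⟨ cong reduction (take-applyUpTo _ (m∸n≤m len (suc d))) ⟩
      reduction (window k g i′)
        ≡⟨ cong reduction (applyUpTo-cong k λ {t} _ → cong g (shift t)) ⟩
      reduction (applyUpTo (λ t → g (i + (suc d + t))) k)
        ≡⟨ cong reduction (drop-applyUpTo (λ t → g (i + t)) (suc d) len) ⟨
      reduction (drop (suc d) (window len g i))
        ≡⟨ reduction-drop (suc d) (window len g i) ⟨
      reduction (drop (suc d) (reduction (window len g i)))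
        ≡⟨ cong (reduction ∘ drop (suc d)) occ ⟩
      reduction (drop (suc d) (toList (P b)))
        ≡⟨ cong (λ l → reduction (drop l (toList (P b))))
          (m∸[m∸n]≡n (≤-trans (m≤n+m (suc d) 2) 2+d<len)) ⟨
      reduction (drop (len ∸ k) (toList (P b)))  ∎)
    where
    open ≡-Reasoning
    i′ = suc i + d
    k = len ∸ suc d
    shift : ∀ t → i′ + t ≡ i + (suc d + t)
    shift t = trans (cong suc (+-assoc i d t)) (sym (+-suc i (d + t)))

  separated : OccursAt g b i → OccursAt g c j → i ≡ j ⊎ i + len ≤ suc j ⊎ j + len ≤ suc i
  separated {i = i} {j = j} occ occ′ with <-cmp i j
  ... | tri≈ _ i≡j _ = inj₁ i≡j
  ... | tri< i<j _ _ with d , refl ← m≤n⇒∃[o]m+o≡n i<j = inj₂ (inj₁ (overlap-free occ occ′))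
  ... | tri> _ _ j<i with d , refl ← m≤n⇒∃[o]m+o≡n j<i = inj₂ (inj₂ (overlap-free occ′ occ))

  IsEnd : ℕ → Set
  IsEnd d = d ≡ 0 ⊎ d ≡ m

  -- The last position `i + m` of the first window is at most the first position `j` of the second,
  -- so a shared position equals both.
  ends : i + len ≤ suc j → d < len → i + d ≡ j + t → d ≡ m × t ≡ 0
  ends {i} {j} {d} {t} i+len≤1+j (s≤s d≤m) eq = ≤-antisym d≤m m≤d , n≤0⇒n≡0 t≤0
    where
    open ≤-Reasoning
    i+m≤j : i + m ≤ j
    i+m≤j = s≤s⁻¹ (subst (_≤ suc j) (+-suc i m) i+len≤1+j)
    m≤d : m ≤ d
    m≤d = +-cancelˡ-≤ i m d (begin
      i + m  ≤⟨ i+m≤j ⟩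
      j      ≤⟨ m≤m+n j t ⟩
      j + t  ≡⟨ eq ⟨
      i + d  ∎)
    t≤0 : t ≤ 0
    t≤0 = +-cancelˡ-≤ j t 0 (begin
      j + t  ≡⟨ eq ⟨
      i + d  ≤⟨ +-monoʳ-≤ i d≤m ⟩
      i + m  ≤⟨ i+m≤j ⟩
      j      ≡⟨ +-identityʳ j ⟨
      j + 0  ∎)

  separated⇒ends : i + len ≤ suc j ⊎ j + len ≤ suc i → d < len → t < len → i + d ≡ j + t →
                   IsEnd d × IsEnd t
  separated⇒ends (inj₁ le) d< _ eq = let d≡m , t≡0 = ends le d< eq in inj₂ d≡m , inj₁ t≡0
  separated⇒ends (inj₂ le) _ t< eq = let t≡m , d≡0 = ends le t< (sym eq) in inj₁ d≡0 , inj₂ t≡m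

  end≡ : ∀ b → IsEnd d → at (P b) d ≡ at (P (not b)) d
  end≡ b (inj₁ refl) = first≡ b
  end≡ b (inj₂ refl) = last≡ b

  -- The exchange writes the entry from offset `t` at offset `d`. At an end the two patterns agree,
  -- so `P b` has equal values at `t` and `d`, and the entries there are equal.
  end-fixed : OccursAt g b j → d < len → t < len → at (P b) t ≡ at (P (not b)) d → IsEnd d →
              g (j + t) ≡ g (j + d)
  end-fixed {b = b} occ d< t< eq end = occursAt-injective occ t< d< (trans eq (sym (end≡ b end)))

  -- The exchange as a relation between sequences

  Covered : (ℕ → ℕ) → ℕ → Set
  Covered g x = ∃[ j ] j < suc x × ∃[ d ] d < len × j + d ≡ x × ∃[ b ] OccursAt g b j

  covered? : ∀ g x → Dec (Covered g x)
  covered? g x = anyUpTo? (λ j → anyUpTo? (λ d → j + d ≟ x ×-dec anyBool? (λ b → occursAt? g b j)) len) (suc x)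

  occursAt⇒covered : OccursAt g b j → d < len → Covered g (j + d)
  occursAt⇒covered {j = j} {d} occ d< = j , s≤s (m≤m+n j d) , d , d< , refl , -, occ

  -- Offsets at which P b has the same value carry the same entry, so the choice
  -- of t is immaterial.
  record Swaps (g h : ℕ → ℕ) : Set where
    field
      swapped : OccursAt g b j → d < len → t < len → at (P b) t ≡ at (P (not b)) d → h (j + d) ≡ g (j + t)
      fixed   : x < n → ¬ Covered g x → h x ≡ g x

  open Swaps

  values⁻ : ∀ b {t} → t < len → ∃[ d ] d < len × at (P b) t ≡ at (P (not b)) d
  values⁻ b {t} t< = let d , d< , eq = values (not b) t< in
    d , d< , sym (subst (λ c → at (P (not b)) d ≡ at (P c) t) (not-involutive b) eq)

  -- Both windows have the same set of values, so ranks in them agree, and the entry written at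
  -- offset `d` has the rank that `P (not b)` prescribes.
  occursAt-swaps⁺ : Swaps g h → OccursAt g b j → OccursAt h (not b) j
  occursAt-swaps⁺ {g} {h} {b} {j} sw occ = occursAt (fits occ) (begin
    reduction (window len h j)                            ≡⟨ reduction-window h j ⟩
    applyUpTo (λ d → rank (window len h j) (h (j + d))) len
      ≡⟨ applyUpTo-cong len rank≡ ⟩
    applyUpTo (at (P (not b))) len                        ≡⟨ toList-at (P (not b)) ⟨
    toList (P (not b))                                    ∎)
    where
    open ≡-Reasoning
    h⊆g : window len h j ⊆ window len g j
    h⊆g x∈ with d , d< , refl ← ∈-applyUpTo⁻ (λ t → h (j + t)) x∈ =
      let t , t< , eq = values b d< in
      subst (_∈ window len g j) (sym (swapped sw occ d< t< eq)) (∈-window g j t<)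
    g⊆h : window len g j ⊆ window len h j
    g⊆h x∈ with t , t< , refl ← ∈-applyUpTo⁻ (λ t → g (j + t)) x∈ =
      let d , d< , eq = values⁻ b t< in
      subst (_∈ window len h j) (swapped sw occ d< t< eq) (∈-window h j d<)
    rank≡ : d < len → rank (window len h j) (h (j + d)) ≡ at (P (not b)) d
    rank≡ {d} d< = let t , t< , eq = values b d< in begin
      rank (window len h j) (h (j + d))  ≡⟨ rank-cong h⊆g g⊆h (h (j + d)) ⟩
      rank (window len g j) (h (j + d))  ≡⟨ cong (rank (window len g j)) (swapped sw occ d< t< eq) ⟩
      rank (window len g j) (g (j + t))  ≡⟨ rank-window occ t< ⟩
      at (P b) t                         ≡⟨ eq ⟩
      at (P (not b)) d                   ∎

  -- If `P (not b)` did not occur in `g` at `j`, then neither would `P b`, so no occurrence would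
  -- start at `j`. Occurrences elsewhere meet this window only in letters that the exchange fixes,
  -- so `P b` would already occur in `g`, a contradiction.
  occursAt-swaps⁻ : Swaps g h → OccursAt h b j → OccursAt g (not b) j
  occursAt-swaps⁻ {g} {h} {b} {j} sw occ with occursAt? g (not b) j
  ... | yes occ′ = occ′
  ... | no ¬occ′ = contradiction (occursAt-cong unchanged occ) ¬occ
    where
    -- If `P b` occurred in `g` at `j`, both patterns would occur in `h` at `j`; they would then
    -- coincide, and `P (not b)` would occur in `g` as well.
    ¬occ : ¬ OccursAt g b j
    ¬occ occ′ = ¬occ′ (occursAt (fits occ′) (trans (reduced occ′) (occursAt-unique occ (occursAt-swaps⁺ sw occ′))))

    unchanged : t < len → h (j + t) ≡ g (j + t)
    unchanged {t} t< with covered? g (j + t)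
    ... | no ¬cov = fixed sw (<-≤-trans (+-monoʳ-< j t<) (fits occ)) ¬cov
    -- Separation is applied within `h`, where `occ` lives, after moving `occ″` there.
    ... | yes (i , _ , d , d< , i+d≡j+t , c , occ″) with separated (occursAt-swaps⁺ sw occ″) occ
    ...   | inj₂ sep = subst (λ x → h x ≡ g x) i+d≡j+t (let u , u< , eq = values c d< in
              trans (swapped sw occ″ d< u< eq)
                    (end-fixed occ″ d< u< eq (proj₁ (separated⇒ends sep d< t< i+d≡j+t))))
    ...   | inj₁ refl with c Bool.≟ b
    ...     | yes refl = contradiction occ″ ¬occ
    ...     | no c≢b   = contradiction (subst (λ c → OccursAt g c j) (Bool.¬-not c≢b) occ″) ¬occ′

  -- Occurrences in `g` and `h` correspond with `b` negated, and `d` and `t` trade places. The same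
  -- correspondence shows that both sequences have the same covered positions.
  swaps-sym : Swaps g h → Swaps h g
  swapped (swaps-sym sw) {b = b} {d = d} occ d< t< eq = sym (swapped sw (occursAt-swaps⁻ sw occ) t< d<
    (trans (sym eq) (cong (λ c → at (P c) _) (sym (not-involutive b)))))
  fixed (swaps-sym sw) x< ¬cov = sym (fixed sw x< λ where
    (j , j< , d , d< , eq , b , occ) → ¬cov (j , j< , d , d< , eq , not b , occursAt-swaps⁺ sw occ))

  swaps-functional : ∀ {h′} → Swaps g h → Swaps g h′ → x < n → h x ≡ h′ x
  swaps-functional {g} {x = x} sw sw′ x< with covered? g x
  ... | no ¬cov = trans (fixed sw x< ¬cov) (sym (fixed sw′ x< ¬cov))
  ... | yes (j , _ , d , d< , refl , b , occ) = let t , t< , eq = values b d< in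
    trans (swapped sw occ d< t< eq) (sym (swapped sw′ occ d< t< eq))

  -- Construction of the exchange

  swap : (ℕ → ℕ) → ℕ → ℕ
  swap g x with covered? g x
  ... | no _ = g x
  ... | yes (j , _ , d , d< , _ , b , _) = g (j + proj₁ (values b d<))

  -- `swap` uses whichever occurrence the search finds, so its choice must not matter. Occurrences
  -- in different windows share only an end of each, where both write the old entry; in the same
  -- window the patterns coincide.
  swapped-unique : ∀ {d′ t′} → OccursAt g b i → OccursAt g c j →
    d < len → t < len → at (P b) t ≡ at (P (not b)) d →
    d′ < len → t′ < len → at (P c) t′ ≡ at (P (not c)) d′ →
    i + d ≡ j + d′ → g (i + t) ≡ g (j + t′)
  swapped-unique {g = g} {b = b} {i = i} {c = c} {d = d} {t = t} {t′ = t′} occ occ′ d< t< eq d′< t′< eq′ i+d≡j+d′ with separated occ occ′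
  ... | inj₂ sep = let end , end′ = separated⇒ends sep d< d′< i+d≡j+d′ in
    trans (end-fixed occ d< t< eq end) (trans (cong g i+d≡j+d′) (sym (end-fixed occ′ d′< t′< eq′ end′)))
  ... | inj₁ refl with refl ← +-cancelˡ-≡ i _ _ i+d≡j+d′ with c Bool.≟ b
  ...   | yes refl = occursAt-injective occ t< t′< (trans eq (sym eq′))
  ...   | no c≢b with refl ← Bool.¬-not c≢b = occursAt-injective occ t< t′< (begin
    at (P b) t              ≡⟨ eq ⟩
    at (P (not b)) d        ≡⟨ P-agree d< ⟨
    at (P b) d              ≡⟨ cong (λ c → at (P c) d) (not-involutive b) ⟨
    at (P (not (not b))) d  ≡⟨ eq′ ⟨
    at (P (not b)) t′       ≡⟨ P-agree t′< ⟨
    at (P b) t′             ∎)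
    where
    open ≡-Reasoning
    P-agree : ∀ {u} → u < len → at (P b) u ≡ at (P (not b)) u
    P-agree = applyUpTo-injective (at (P b)) (at (P (not b))) len
      (trans (sym (toList-at (P b))) (trans (occursAt-unique occ occ′) (toList-at (P (not b)))))

  swap-swaps : (∀ {x} → x < n → h x ≡ swap g x) → Swaps g h
  swapped (swap-swaps {h} {g} h≡) {j = j} {d} {t} occ d< t< eq =
    trans (h≡ (<-≤-trans (+-monoʳ-< j d<) (fits occ))) swap≡
    where
    swap≡ : swap g (j + d) ≡ g (j + t)
    swap≡ with covered? g (j + d)
    ... | no ¬cov = contradiction (occursAt⇒covered occ d<) ¬cov
    ... | yes (i , _ , d′ , d′< , eq′ , c , occ′) = let t′ , t′< , eq″ = values c d′< in
      swapped-unique occ′ occ d′< t′< eq″ d< t< eq eq′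
  fixed (swap-swaps {h} {g} h≡) {x = x} x< ¬cov = trans (h≡ x<) swap≡
    where
    swap≡ : swap g x ≡ g x
    swap≡ with covered? g x
    ... | no _    = refl
    ... | yes cov = contradiction cov ¬cov

  -- Preservation of inversion sequences

  swaps-bounded : Swaps g h → (∀ {x} → x < n → g x ≤ x) → x < n → h x ≤ x
  swaps-bounded {g} {h} {x} sw g≤ x< with covered? g x
  ... | no ¬cov = subst (_≤ x) (sym (fixed sw x< ¬cov)) (g≤ x<)
  ... | yes (j , _ , d , d< , refl , b , occ) =
    let t , t< , eq = values b d< in subst (_≤ j + d) (sym (swapped sw occ d< t< eq)) (bound t< eq (change b d<))
    where
    open ≤-Reasoning
    w = window len g j
    entry≤ : t < len → g (j + t) ≤ j + t
    entry≤ t< = g≤ (<-≤-trans (+-monoʳ-< j t<) (fits occ))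
    bound : t < len → at (P b) t ≡ at (P (not b)) d → ∃[ u ] u < len ×
      (u ≤ d × at (P (not b)) d ≤ at (P b) u ⊎ d < u × at (P (not b)) d + u ≤ at (P b) u + d) → g (j + t) ≤ j + d
    -- An entry at an earlier offset `u` is at least the new entry and at most `j + u`.
    bound {t} t< eq (u , u< , inj₁ (u≤d , le)) = begin
      g (j + t)  ≤⟨ rank-cancel-≤ w (∈-window g j u<) (begin
          rank w (g (j + t))  ≡⟨ rank-window occ t< ⟩
          at (P b) t          ≡⟨ eq ⟩
          at (P (not b)) d    ≤⟨ le ⟩
          at (P b) u          ≡⟨ rank-window occ u< ⟨
          rank w (g (j + u))  ∎) ⟩
      g (j + u)  ≤⟨ entry≤ u< ⟩
      j + u      ≤⟨ +-monoʳ-≤ j u≤d ⟩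
      j + d      ∎
    -- The entry at the later offset `u` exceeds the new one by `k`. By `rank-gap` this is at least
    -- the difference of ranks, which is at least `u - d`.
    bound {t} t< eq (u , u< , inj₂ (d<u , le)) = +-cancelˡ-≤ k _ _ (begin
      k + g (j + t)  ≡⟨ y≡ ⟩
      g (j + u)      ≤⟨ entry≤ u< ⟩
      j + u          ≤⟨ +-monoʳ-≤ j u≤k+d ⟩
      j + (k + d)    ≡⟨ +-assoc j k d ⟨
      j + k + d      ≡⟨ cong (_+ d) (+-comm j k) ⟩
      k + j + d      ≡⟨ +-assoc k j d ⟩
      k + (j + d)    ∎)
      where
      v = at (P (not b)) d
      k = g (j + u) ∸ g (j + t)
      rank≡v : rank w (g (j + t)) ≡ v
      rank≡v = trans (rank-window occ t<) eq
      v<Pu : v < at (P b) u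
      v<Pu = +-cancelʳ-< u _ _ (≤-<-trans le (+-monoʳ-< (at (P b) u) d<u))
      -- As `v < at (P b) u`, the subtraction in `k` is not truncated.
      y≡ : k + g (j + t) ≡ g (j + u)
      y≡ = m∸n+n≡m (rank-cancel-≤ {x = g (j + t)} w (∈-window g j u<) (begin
        rank w (g (j + t))  ≡⟨ rank≡v ⟩
        v                   ≤⟨ <⇒≤ v<Pu ⟩
        at (P b) u          ≡⟨ rank-window occ u< ⟨
        rank w (g (j + u))  ∎))
      Pu≤k+v : at (P b) u ≤ k + v
      Pu≤k+v = begin
        at (P b) u              ≡⟨ rank-window occ u< ⟨
        rank w (g (j + u))      ≡⟨ cong (rank w) y≡ ⟨
        rank w (k + g (j + t))  ≤⟨ rank-gap w (g (j + t)) k ⟩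
        k + rank w (g (j + t))  ≡⟨ cong (k +_) rank≡v ⟩
        k + v                   ∎
      u≤k+d : u ≤ k + d
      u≤k+d = +-cancelˡ-≤ v _ _ (begin
        v + u           ≤⟨ le ⟩
        at (P b) u + d  ≤⟨ +-monoˡ-≤ d Pu≤k+v ⟩
        k + v + d       ≡⟨ cong (_+ d) (+-comm k v) ⟩
        v + k + d       ≡⟨ +-assoc v k d ⟩
        v + (k + d)     ∎)

  -- Return to vectors, and counting

  occurs⇒occursAt : ∀ (e : Vec ℕ n) i → Occurs (P b) e i → OccursAt (at e) b (toℕ i)
  occurs⇒occursAt {b} e i occ = occursAt fits′ (trans (cong reduction (sym (window-at e (toℕ i) fits′))) occ)
    where
    open ≡-Reasoning
    -- Reduction preserves length, so a window cut short by the end of `e` cannot match a pattern of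
    -- `len` letters.
    len≡ : len ⊓ (n ∸ toℕ i) ≡ len
    len≡ = begin
      len ⊓ (n ∸ toℕ i)                                    ≡⟨ cong (λ k → len ⊓ (k ∸ toℕ i)) (length-toList e) ⟨
      len ⊓ (length (toList e) ∸ toℕ i)                    ≡⟨ cong (len ⊓_) (length-drop (toℕ i) (toList e)) ⟨
      len ⊓ length (drop (toℕ i) (toList e))               ≡⟨ length-take len (drop (toℕ i) (toList e)) ⟨
      length (take len (drop (toℕ i) (toList e)))          ≡⟨ length-map _ (take len (drop (toℕ i) (toList e))) ⟨
      length (reduction (take len (drop (toℕ i) (toList e)))) ≡⟨ cong length occ ⟩
      length (toList (P b))                                ≡⟨ length-toList (P b) ⟩
      len                                                  ∎
    fits′ : toℕ i + len ≤ n
    fits′ = subst (_≤ n) (+-comm len (toℕ i))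
      (m≤o∸n⇒m+n≤o len (<⇒≤ (toℕ<n i)) (m⊓n≡m⇒m≤n len≡))

  occursAt⇒occurs : ∀ (e : Vec ℕ n) i → OccursAt (at e) b (toℕ i) → Occurs (P b) e i
  occursAt⇒occurs e i (occursAt le eq) = trans (cong reduction (window-at e (toℕ i) le)) eq

  abstract
    swapVec : Vec ℕ n → Vec ℕ n
    swapVec e = tabulate (swap (at e) ∘ toℕ)

    swapVec-swaps : ∀ e → Swaps (at e) (at (swapVec e))
    swapVec-swaps e = swap-swaps (at-tabulate (swap (at e)) n)

  -- By symmetry `e` is an exchange of `swapVec e`, and so is `swapVec (swapVec e)`.
  swapVec-involutive : ∀ e → swapVec (swapVec e) ≡ e
  swapVec-involutive e = at-injective (swapVec (swapVec e)) e
    (swaps-functional (swapVec-swaps (swapVec e)) (swaps-sym (swapVec-swaps e)))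

  swapVec-injective : ∀ {e e′} → swapVec e ≡ swapVec e′ → e ≡ e′
  swapVec-injective {e} {e′} eq =
    trans (sym (swapVec-involutive e)) (trans (cong swapVec eq) (swapVec-involutive e′))

  swapVec-inversionSequence : ∀ e → InversionSequence e → InversionSequence (swapVec e)
  swapVec-inversionSequence e inv i =
    s≤s (subst (_≤ toℕ i) (sym (lookup-at (swapVec e) i)) (swaps-bounded (swapVec-swaps e) bounded (toℕ<n i)))
    where
    bounded : ∀ {x} → x < n → at e x ≤ x
    bounded x<n = subst (λ y → at e y ≤ y) (toℕ-fromℕ< x<n)
      (subst (_≤ _) (lookup-at e (fromℕ< x<n)) (s≤s⁻¹ (inv (fromℕ< x<n))))

  Em-swapVec : ∀ b e → Em (P (not b)) (swapVec e) ≡ Em (P b) e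
  Em-swapVec b e = tabulate-cong λ i → does-⇔ (mk⇔ (from i) (to i)) (occurs? (P (not b)) (swapVec e) i) (occurs? (P b) e i)
    where
    to : ∀ i → Occurs (P b) e i → Occurs (P (not b)) (swapVec e) i
    to i occ = occursAt⇒occurs (swapVec e) i (occursAt-swaps⁺ (swapVec-swaps e) (occurs⇒occursAt e i occ))
    from : ∀ i → Occurs (P (not b)) (swapVec e) i → Occurs (P b) e i
    from i occ = occursAt⇒occurs e i (subst (λ c → OccursAt (at e) c (toℕ i)) (not-involutive b)
      (occursAt-swaps⁻ (swapVec-swaps e) (occurs⇒occursAt (swapVec e) i occ)))

  -- `swapVec` injects one set into the other. Equalities follow later by antisymmetry, with the
  -- roles exchanged.
  #𝐈-swapVec : ∀ {ℓ ℓ′} {Q : Pred (Vec ℕ n) ℓ} {R : Pred (Vec ℕ n) ℓ′} (Q? : Decidable Q) (R? : Decidable R) →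
               (∀ e → Q e → R (swapVec e)) → #𝐈 Q? ≤ #𝐈 R?
  #𝐈-swapVec Q? R? Q⇒R = subst (_≤ #𝐈 R?) (length-map swapVec (filter Q? (inversionSequences n)))
    (unique-⊆⇒length≤ (Unique.map⁺ swapVec-injective (Unique.filter⁺ Q? (inversionSequences-unique n))) ⊆R)
    where
    ⊆R : List.map swapVec (filter Q? (inversionSequences n)) ⊆ filter R? (inversionSequences n)
    ⊆R e∈ with e , e∈ , refl , q ← ∈-map∘filter⁻ swapVec Q? {xs = inversionSequences n} e∈ = ∈-filter⁺ R?
      (∈-inversionSequences⁺ (swapVec e) (swapVec-inversionSequence e (∈-inversionSequences⁻ e e∈))) (Q⇒R e q)

  Em²-swap : ∀ (S T : Subset n) → #Em² (P true) (P false) S T ≤ #Em² (P true) (P false) T S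
  Em²-swap S T = #𝐈-swapVec _ _ λ e (eq , eq′) →
    trans (Em-swapVec false e) eq′ , trans (Em-swapVec true e) eq

  Em-swap : ∀ b (T : Subset n) → #Em (P b) T ≤ #Em (P (not b)) T
  Em-swap b T = #𝐈-swapVec _ _ λ e → trans (Em-swapVec b e)

-- Consequences of the pattern and interchangeability conditions

∈⇒at : ∀ {v} {p : Vec ℕ r} → v Vec.∈ p → ∃[ t ] t < r × at p t ≡ v
∈⇒at {p = p} v∈p = let i = VecAny.index v∈p in
  toℕ i , toℕ<n i , trans (sym (lookup-at p i)) (sym (VecAny.lookup-index v∈p))

at∈ : ∀ (p : Vec ℕ r) {t} → t < r → at p t Vec.∈ p
at∈ p t<r = subst (Vec._∈ p) (trans (lookup-at p (fromℕ< t<r)) (cong (at p) (toℕ-fromℕ< t<r))) (∈-lookup (fromℕ< t<r) p)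

≤maximum : ∀ {v} (p : Vec ℕ r) → v Vec.∈ p → v ≤ maximum p
≤maximum p v∈p = All.lookup (xs≤max 0 (toList p)) (∈-toList⁺ v∈p)

maximum∈ : ∀ {m} (p : Vec ℕ (suc m)) → maximum p Vec.∈ p
maximum∈ p@(x ∷ _) with argmax-sel id 0 (toList p)
... | inj₂ max∈ = ∈-toList⁻ max∈
-- If the maximum is the default 0, the head is at most 0 and attains it.
... | inj₁ max≡0 = VecAny.here (trans max≡0 (sym (n≤0⇒n≡0 (subst (x ≤_) max≡0 (≤maximum p (VecAny.here refl))))))

downward-closed : ∀ {p : Vec ℕ r} → IsPattern p → ∀ {u v} → u ≤ v → v Vec.∈ p → u Vec.∈ p
downward-closed {p = p} isPattern u≤v = go (≤⇒≤′ u≤v)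
  where
  go : ∀ {u v} → u ≤′ v → v Vec.∈ p → u Vec.∈ p
  go ≤′-refl       v∈p = v∈p
  go (≤′-step u≤v) v∈p = go u≤v (IsPattern.gapless isPattern v∈p)

-- A pattern takes every value up to its maximum, and the maxima agree.
common-values : ∀ {m} (p p′ : Vec ℕ (suc m)) → IsPattern p → maximum p ≡ maximum p′ →
                ∀ {d} → d < suc m → ∃[ t ] t < suc m × at p t ≡ at p′ d
common-values p p′ isPattern max≡ d< = ∈⇒at (downward-closed isPattern
  (subst (at p′ _ ≤_) (sym max≡) (≤maximum p′ (at∈ p′ d<))) (maximum∈ p))

<max⇒∃ : ∀ {v} xs → v < max 0 xs → ∃[ x ] x ∈ xs × v < x
<max⇒∃ {v} xs v<max = [ (λ max≡0 → contradiction (subst (v <_) max≡0 v<max) λ ()) , (λ max∈ → -, max∈ , v<max) ]′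
  (argmax-sel id 0 xs)

-- A positive value can only be bounded by a listed entry, not by the default 0; for the value 0,
-- offset 0 serves. Moving the subtraction across the inequality avoids truncation later.
≤changeBound : ∀ {m v} (p : Vec ℕ (suc m)) (i : Fin (suc m)) → v ≤ changeBound p i → ∃[ t ] t < suc m ×
  (t ≤ toℕ i × v ≤ at p t ⊎ toℕ i < t × v + t ≤ at p t + toℕ i)
≤changeBound {m} {zero} p i _ = 0 , z<s , inj₁ (z≤n , z≤n)
≤changeBound {m} {suc v} p i v<bound =
  let x , x∈ , v<x = <max⇒∃ (early ++ late) v<bound in
  [ fromEarly v<x , fromLate v<x ]′ (∈-++⁻ early x∈)
  where
  early = List.map (λ j → lookup p j) (filter (λ j → toℕ j ≤? toℕ i) (allFin (suc m)))
  late  = List.map (λ j → (lookup p j + toℕ i) ∸ toℕ j) (filter (λ j → toℕ i <? toℕ j) (allFin (suc m)))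

  Goal : Set
  Goal = ∃[ t ] t < suc m × (t ≤ toℕ i × suc v ≤ at p t ⊎ toℕ i < t × suc v + t ≤ at p t + toℕ i)

  fromEarly : ∀ {x} → v < x → x ∈ early → Goal
  fromEarly v<x x∈ =
    let j , _ , x≡ , j≤i = ∈-map∘filter⁻ (λ j → lookup p j) (λ j → toℕ j ≤? toℕ i) {xs = allFin (suc m)} x∈
    in toℕ j , toℕ<n j , inj₁ (j≤i , subst (v <_) (trans x≡ (lookup-at p j)) v<x)

  fromLate : ∀ {x} → v < x → x ∈ late → Goal
  fromLate v<x x∈ =
    let j , _ , x≡ , i<j = ∈-map∘filter⁻ (λ j → (lookup p j + toℕ i) ∸ toℕ j) (λ j → toℕ i <? toℕ j)
          {xs = allFin (suc m)} x∈
        v<∸ = subst (v <_) x≡ v<x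
        -- The difference exceeds `v`, so it is nonzero and was not truncated.
        j≤  = <⇒≤ (m∸n≢0⇒n<m (m<n⇒n≢0 v<∸))
    in toℕ j , toℕ<n j ,
       inj₂ (i<j , subst (λ y → suc v + toℕ j ≤ y + toℕ i) (lookup-at p j) (m≤o∸n⇒m+n≤o (suc v) j≤ v<∸))

last-at : ∀ {m} (p : Vec ℕ (suc m)) → Vec.last p ≡ at p m
last-at {zero}  (_ ∷ [])     = refl
last-at {suc m} (_ ∷ x ∷ xs) = last-at (x ∷ xs)

head-at : ∀ {m} (p : Vec ℕ (suc m)) → Vec.head p ≡ at p 0
head-at (_ ∷ _) = refl

mainTheorem2 : ∀ {m : ℕ} (p p′ : Vec ℕ (suc m)) →
    IsPattern p → IsPattern p′ →
    NonOverlapping p → NonOverlapping p′ →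
    MutuallyNonOverlapping p p′ →
    Interchangeable p p′ →
    (∀ n (S T : Subset n) → #Em² p p′ S T ≡ #Em² p p′ T S) × SuperStronglyWilfEquivalent p p′
mainTheorem2 {m} p p′ isP isP′ avoid₁₁ avoid₂₂ (avoid₁₂ , avoid₂₁) (p⇝p′ , p′⇝p) =
  (λ n S T → ≤-antisym (Em²-swap n S T) (Em²-swap n T S)) ,
  (λ n T → ≤-antisym (Em-swap n true T) (Em-swap n false T))
  where
  P : Bool → Vec ℕ (suc m)
  P b = if b then p else p′

  isPattern : ∀ b → IsPattern (P b)
  isPattern true  = isP
  isPattern false = isP′

  avoid : ∀ b c → PrefixesAvoidSuffixes (P b) (P c)
  avoid true  true  = avoid₁₁
  avoid true  false = avoid₁₂
  avoid false true  = avoid₂₁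
  avoid false false = avoid₂₂

  changeable : ∀ b → Changeable (P b) (P (not b))
  changeable true  = p⇝p′
  changeable false = p′⇝p

  open module C b = Changeable (changeable b)

  change′ : ∀ b {d} → d < suc m → ∃[ t ] t < suc m ×
    (t ≤ d × at (P (not b)) d ≤ at (P b) t ⊎ d < t × at (P (not b)) d + t ≤ at (P b) t + d)
  change′ b d< = subst (λ d → ∃[ t ] t < suc m ×
      (t ≤ d × at (P (not b)) d ≤ at (P b) t ⊎ d < t × at (P (not b)) d + t ≤ at (P b) t + d))
    (toℕ-fromℕ< d<)
    (≤changeBound (P b) (fromℕ< d<)
      (subst (_≤ changeBound (P b) (fromℕ< d<)) (lookup-at (P (not b)) (fromℕ< d<)) (change b (fromℕ< d<))))

  open Swap P avoid
    (λ b → trans (sym (head-at (P b))) (trans (sameHead b) (head-at (P (not b)))))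
    (λ b → trans (sym (last-at (P b))) (trans (sameLast b) (last-at (P (not b)))))
    (λ b → common-values (P b) (P (not b)) (isPattern b) (sameMaximum b))
    change′
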